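{- Let $n$ be a positive integer and let $A(n)=(a_{ij})$, $p=p(n)$, $pp=pp(n)$, $b(n)$ be as in the context. Let $m\ge 1$ be an integer such that $\overline{p}=pm$ satisfies $\lfloor \overline{p}/2\rfloor> b(n)$, put $r=\lfloor\overline{p}/2\rfloor$, let $v$ be an integer with $v\ge pp+\overline{p}$, and let $B=(b_{ij})_{1\le i,j\le\overline{p}}$ be the $\overline{p}\times\overline{p}$ matrix with $b_{ij}=a_{v+i,v+j}$ if $i-r\le j\le i+r$; $b_{ij}=a_{v+i,v+j-\overline{p}}$ if $j>i+r$; $b_{ij}=a_{v+i,v+j+\overline{p}}$ if $j<i-r$. Then every row of $B$ contains exactly $n+1$ ones.
   Context: $\mathbb{N}=\{1,2,3,\dots\}$. Fix a positive integer $n$. The infinite $\{0,1\}$-matrix $A(n)=(a_{ij})_{i,j\in\mathbb{N}}$ is defined recursively. Its entries are determined row by row (row $1$ first), and within each row from left to right, so that $a_{kl}$ is determined after all $a_{ij}$ with $i<k$ and all $a_{kj}$ with $j<l$. One sets $a_{kl}=1$ if and only if all of the following hold: (1) $\sum_{j<l}a_{kj}<n+1$; (2) $\sum_{i<k}a_{il}<n+1$; (3) there is no pair $(i,j)$ with $1\le i<k$, $1\le j<l$ and $a_{ij}=a_{il}=a_{kj}=1$. Otherwise $a_{kl}=0$. The matrix $A(n)$ is eventually periodic along the diagonal: there exist $c\ge0$, $q\ge1$ with $a_{i+q,j+q}=a_{ij}$ for all $i>c$, $j\ge1$. The period $p=p(n)$ is the smallest $q\ge1$ for which such a $c$ exists,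 and the preperiod $pp=pp(n)$ is the smallest $c\ge 0$ with $a_{i+p,j+p}=a_{ij}$ for all $i>c$, $j\ge 1$. Define $b(n)=\max\{|j-i| : i,j\ge1,\ a_{ij}=1,\ i>pp(n)\}$. -}

module Defs where

open import Data.Bool using (Bool; false; T)
open import Data.Bool.Properties using (T?)
open import Data.Fin using (Fin; toℕ)
open import Data.Fin.Properties using (any?)
open import Data.Nat using (ℕ; zero; suc; _+_; _∸_; _≤_; _<_; _≤?_; _<?_; ∣_-_∣; ⌊_/2⌋)
open import Data.Product using (_×_; ∃-syntax)
open import Data.Vec using (Vec; []; _∷ʳ_; lookup; count; tabulate)
open import Relation.Binary.PropositionalEquality using (_≡_)
open import Relation.Nullary using (¬_; Dec; does; yes; no)
open import Relation.Nullary.Decidable using (_×-dec_; ¬?)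

ones : ∀ {l} → Vec Bool l → ℕ
ones = count T?

-- Conditions for placing a one at position (k, l): `left` holds the
-- entries a_kj with j < l, `above` the entries a_il with i < k, and `block`
-- the entries a_ij with i < k and j < l.
Admissible : ∀ (n : ℕ) {k l} → Vec Bool l → Vec Bool k → Vec (Vec Bool l) k → Set
Admissible n left above block =
    ones left < n + 1
  × ones above < n + 1
  × ¬ (∃[ i ] ∃[ j ] (T (lookup (lookup block i) j) × T (lookup above i) × T (lookup left j)))

admissible? : ∀ n {k l} (left : Vec Bool l) (above : Vec Bool k) (block : Vec (Vec Bool l) k) →
              Dec (Admissible n left above block)
admissible? n left above block =
        (ones left <? n + 1)
  ×-dec (ones above <? n + 1)
  ×-dec ¬? (any? λ i → any? λ j →
              T? (lookup (lookup block i) j) ×-dec T? (lookup above i) ×-dec T? (lookup left j))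

-- The matrix with indices starting at 0: entry n k l = a_{k+1,l+1}.
entry     : ℕ → ℕ → ℕ → Bool
rowLeft   : ℕ → ∀ (k l : ℕ) → Vec Bool l
colAbove  : ℕ → ∀ (k l : ℕ) → Vec Bool k
blockNW   : ℕ → ∀ (k l : ℕ) → Vec (Vec Bool l) k

entry n k l = does (admissible? n (rowLeft n k l) (colAbove n k l) (blockNW n k l))

rowLeft n k zero    = []
rowLeft n k (suc l) = rowLeft n k l ∷ʳ entry n k l

colAbove n zero    l = []
colAbove n (suc k) l = colAbove n k l ∷ʳ entry n k l

blockNW n zero    l = []
blockNW n (suc k) l = blockNW n k l ∷ʳ rowLeft n k l

-- A(n) with indices starting at 1; row 0 and column 0 are junk (all false).
A : ℕ → ℕ → ℕ → Bool
A n zero    _       = false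
A n (suc _) zero    = false
A n (suc i) (suc j) = entry n i j

IsLeast : (ℕ → Set) → ℕ → Set
IsLeast P x = P x × (∀ y → P y → x ≤ y)

PeriodicFrom : (n c q : ℕ) → Set
PeriodicFrom n c q = ∀ i j → c < i → 1 ≤ j → A n (i + q) (j + q) ≡ A n i j

IsPeriod : (n p : ℕ) → Set
IsPeriod n = IsLeast (λ q → 1 ≤ q × ∃[ c ] PeriodicFrom n c q)

IsPreperiod : (n p pp : ℕ) → Set
IsPreperiod n p = IsLeast (λ c → PeriodicFrom n c p)

IsMaxOffset : (n pp b : ℕ) → Set
IsMaxOffset n pp b =
    (∃[ i ] ∃[ j ] (1 ≤ i × 1 ≤ j × T (A n i j) × pp < i × ∣ j - i ∣ ≡ b))
  × (∀ i j → 1 ≤ i → 1 ≤ j → T (A n i j) → pp < i → ∣ j - i ∣ ≤ b)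

-- The entry b_ij for 1-based i and j, where s is the size of B. The test
-- i - r ≤ j is written i ≤ j + r; the truncated subtraction v + j ∸ s is exact
-- when s ≤ v.
entryB : (n s v i j : ℕ) → Bool
entryB n s v i j with i ≤? j + ⌊ s /2⌋ | j ≤? i + ⌊ s /2⌋
... | yes _ | yes _ = A n (v + i) (v + j)
... | yes _ | no  _ = A n (v + i) (v + j ∸ s)
... | no  _ | _     = A n (v + i) (v + j + s)

B : (n s v : ℕ) → Fin s → Fin s → Bool
B n s v i j = entryB n s v (suc (toℕ i)) (suc (toℕ j))

onesInRow : ∀ {s t} → (Fin s → Fin t → Bool) → Fin s → ℕ
onesInRow M i = ones (tabulate (M i))

{-# OPTIONS --safe #-}

-- Every row of A(n) contains exactly n + 1 ones: it never has more by
-- condition (1), and if all earlier rows are exhausted before column L, then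
-- from column L on conditions (2) and (3) hold vacuously, so row k receives
-- ones until it has n + 1 of them. Past the preperiod the ones of row k lie at
-- distance less than r = ⌊s/2⌋ from the diagonal. As 2r ≤ s, each entry of B is
-- therefore the sum of the three entries of A at columns v + j - s, v + j and
-- v + j + s, at most one of which is nonzero. Summed over j, a row of B counts the
-- ones of a row of A in a window of width 3s containing all of them.
module Submission where

open import Data.Bool using (Bool; true; false; T)
open import Data.Fin using (Fin; zero; suc; toℕ)
open import Data.Fin.Properties using (toℕ<n)
open import Data.Nat using (ℕ; zero; suc; _+_; _*_; _∸_; _≤_; _<_; _≤?_; _<?_; z≤n; s≤s; ∣_-_∣; ⌊_/2⌋; ⌈_/2⌉)
open import Data.Nat.Properties
open import Data.Nat.Solver using (module +-*-Solver)
open import Data.Product using (_,_; proj₂; ∃-syntax)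
open import Data.Sum using (_⊎_; inj₁; inj₂)
open import Data.Unit using (tt)
open import Data.Vec using (Vec; []; _∷_; _∷ʳ_; lookup; tabulate)
open import Function using (_∘_)
open import Relation.Binary.PropositionalEquality using (_≡_; refl; sym; trans; cong; cong₂; subst; module ≡-Reasoning)
open import Relation.Nullary using (¬_; yes; no; contradiction)
open import Relation.Nullary.Decidable using (dec-true; dec-false)
open import Defs

-- Counting ones in initial segments of Boolean sequences.

indicator : Bool → ℕ
indicator false = 0
indicator true  = 1

-- Sequences on all of ℕ, rather than vectors, allow windows to be shifted and joined without index
-- casts.
count< : (ℕ → Bool) → ℕ → ℕ
count< f zero    = 0
count< f (suc l) = count< f l + indicator (f l)

count<-+ : ∀ f a d → count< f (a + d) ≡ count< f a + count< (λ x → f (a + x)) d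
count<-+ f a zero = trans (cong (count< f) (+-identityʳ a)) (sym (+-identityʳ _))
count<-+ f a (suc d) = begin
  count< f (a + suc d)                                    ≡⟨ cong (count< f) (+-suc a d) ⟩
  count< f (a + d) + indicator (f (a + d))                ≡⟨ cong (_+ indicator (f (a + d))) (count<-+ f a d) ⟩
  count< f a + count< (λ x → f (a + x)) d + indicator (f (a + d)) ≡⟨ +-assoc (count< f a) _ _ ⟩
  count< f a + count< (λ x → f (a + x)) (suc d)           ∎
  where open ≡-Reasoning

count<-mono : ∀ f {a b} → a ≤ b → count< f a ≤ count< f b
count<-mono f {a} {b} a≤b = begin
  count< f a                                     ≤⟨ m≤m+n _ _ ⟩
  count< f a + count< (λ x → f (a + x)) (b ∸ a)  ≡⟨ count<-+ f a (b ∸ a) ⟨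
  count< f (a + (b ∸ a))                         ≡⟨ cong (count< f) (m+[n∸m]≡n a≤b) ⟩
  count< f b                                     ∎
  where open ≤-Reasoning

count<-false : ∀ f l → (∀ x → x < l → f x ≡ false) → count< f l ≡ 0
count<-false f zero    off = refl
count<-false f (suc l) off
  rewrite off l ≤-refl | count<-false f l (λ x x<l → off x (m<n⇒m<1+n x<l)) = refl

-- Comparing indicators also encodes disjointness: at each point at most one of the three sequences
-- is true.
count<-sum₃ : ∀ g f₀ f₁ f₂ l →
  (∀ x → x < l → indicator (g x) ≡ indicator (f₀ x) + (indicator (f₁ x) + indicator (f₂ x))) →
  count< g l ≡ count< f₀ l + (count< f₁ l + count< f₂ l)
count<-sum₃ g f₀ f₁ f₂ zero    eq = refl
count<-sum₃ g f₀ f₁ f₂ (suc l) eq =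
  trans (cong₂ _+_ (count<-sum₃ g f₀ f₁ f₂ l (λ x x<l → eq x (m<n⇒m<1+n x<l))) (eq l ≤-refl))
        (solve 6 (λ a b c x y z → (a :+ (b :+ c)) :+ (x :+ (y :+ z))
                                := (a :+ x) :+ ((b :+ y) :+ (c :+ z))) refl
               (count< f₀ l) (count< f₁ l) (count< f₂ l) _ _ _)
  where open +-*-Solver

ones-∷ : ∀ {l} x (xs : Vec Bool l) → ones (x ∷ xs) ≡ indicator x + ones xs
ones-∷ false xs = refl
ones-∷ true  xs = refl

ones-∷ʳ : ∀ {l} (xs : Vec Bool l) x → ones (xs ∷ʳ x) ≡ ones xs + indicator x
ones-∷ʳ []       false = refl
ones-∷ʳ []       true  = refl
ones-∷ʳ (y ∷ xs) x rewrite ones-∷ y (xs ∷ʳ x) | ones-∷ y xs | ones-∷ʳ xs x =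
  sym (+-assoc (indicator y) _ _)

ones-tabulate : ∀ f l → ones (tabulate {n = l} (f ∘ toℕ)) ≡ count< f l
ones-tabulate f zero    = refl
ones-tabulate f (suc l) = begin
  ones (tabulate {n = suc l} (f ∘ toℕ))                       ≡⟨ ones-∷ (f 0) (tabulate {n = l} (f ∘ suc ∘ toℕ)) ⟩
  indicator (f 0) + ones (tabulate {n = l} (f ∘ suc ∘ toℕ))   ≡⟨ cong (indicator (f 0) +_) (ones-tabulate (f ∘ suc) l) ⟩
  indicator (f 0) + count< (f ∘ suc) l                        ≡⟨ count<-+ f 1 l ⟨
  count< f (suc l)                                            ∎
  where open ≡-Reasoning

T-lookup⇒ones>0 : ∀ {l} (xs : Vec Bool l) i → T (lookup xs i) → 0 < ones xs
T-lookup⇒ones>0 (true  ∷ xs) zero    t = s≤s z≤n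
T-lookup⇒ones>0 (false ∷ xs) (suc i) t = T-lookup⇒ones>0 xs i t
T-lookup⇒ones>0 (true  ∷ xs) (suc i) t = s≤s z≤n

-- Row sums of A(n).

ones-rowLeft : ∀ n k l → ones (rowLeft n k l) ≡ count< (entry n k) l
ones-rowLeft n k zero    = refl
ones-rowLeft n k (suc l) =
  trans (ones-∷ʳ (rowLeft n k l) _) (cong (_+ indicator (entry n k l)) (ones-rowLeft n k l))

ones-colAbove : ∀ n k l → ones (colAbove n k l) ≡ count< (λ i → entry n i l) k
ones-colAbove n zero    l = refl
ones-colAbove n (suc k) l =
  trans (ones-∷ʳ (colAbove n k l) _) (cong (_+ indicator (entry n k l)) (ones-colAbove n k l))

full⇒entry-false : ∀ n k l → n + 1 ≤ count< (entry n k) l → entry n k l ≡ false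
full⇒entry-false n k l full =
  dec-false (admissible? n (rowLeft n k l) (colAbove n k l) (blockNW n k l))
    λ (left< , _) → <⇒≱ left< (subst (n + 1 ≤_) (sym (ones-rowLeft n k l)) full)

-- An empty column has 0 < n + 1 ones, which gives (2), and a pattern violating (3) would need a one
-- in that column.
empty-column⇒entry-true : ∀ n k l → (∀ i → i < k → entry n i l ≡ false) →
  count< (entry n k) l < n + 1 → entry n k l ≡ true
empty-column⇒entry-true n k l empty room =
  dec-true (admissible? n (rowLeft n k l) (colAbove n k l) (blockNW n k l))
    ( subst (_< n + 1) (sym (ones-rowLeft n k l)) room
    , subst (_< n + 1) (sym above≡0) (m≤n+m 1 n)
    , λ (i , _ , _ , t , _) → n≮0 (subst (0 <_) above≡0 (T-lookup⇒ones>0 (colAbove n k l) i t)) )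
  where
  above≡0 : ones (colAbove n k l) ≡ 0
  above≡0 = trans (ones-colAbove n k l) (count<-false _ k empty)

row-count≤ : ∀ n k l → count< (entry n k) l ≤ n + 1
row-count≤ n k zero = z≤n
row-count≤ n k (suc l) with count< (entry n k) l <? n + 1
... | no full rewrite full⇒entry-false n k l (≮⇒≥ full) | +-identityʳ (count< (entry n k) l) =
  row-count≤ n k l
... | yes room with entry n k l
...   | false rewrite +-identityʳ (count< (entry n k) l) = <⇒≤ room
...   | true  rewrite +-comm (count< (entry n k) l) 1 = room

EmptyFrom : (n k L : ℕ) → Set
EmptyFrom n k L = ∀ i → i < k → ∀ l → L ≤ l → entry n i l ≡ false

-- At column `L + d` the row either has its n + 1 ones already or receives another one.
row-count-grows : ∀ n k L → EmptyFrom n k L → ∀ d → d ≤ n + 1 → d ≤ count< (entry n k) (L + d)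
row-count-grows n k L empty zero    d≤ = z≤n
row-count-grows n k L empty (suc d) d< rewrite +-suc L d
  with count< (entry n k) (L + d) <? n + 1
... | no full = ≤-trans d< (≤-trans (≮⇒≥ full) (m≤m+n _ _))
... | yes room
  rewrite empty-column⇒entry-true n k (L + d) (λ i i<k → empty i i<k (L + d) (m≤m+n L d)) room
        | +-comm (count< (entry n k) (L + d)) 1 =
  s≤s (row-count-grows n k L empty d (<⇒≤ d<))

row-full : ∀ n k L → EmptyFrom n k L → ∀ l → L + (n + 1) ≤ l → n + 1 ≤ count< (entry n k) l
row-full n k L empty l L≤l =
  ≤-trans (row-count-grows n k L empty (n + 1) ≤-refl) (count<-mono (entry n k) L≤l)

-- Row `k` is full after n + 1 columns beyond the bound for the earlier rows, and a full row stays
-- empty by (1).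
rows-eventually-empty : ∀ n k → ∃[ L ] EmptyFrom n k L
rows-eventually-empty n zero    = 0 , λ i ()
rows-eventually-empty n (suc k) with rows-eventually-empty n k
... | L , empty = L + (n + 1) , λ i i<1+k l L≤l → step i (m<1+n⇒m<n∨m≡n i<1+k) l L≤l
  where
  step : ∀ i → i < k ⊎ i ≡ k → ∀ l → L + (n + 1) ≤ l → entry n i l ≡ false
  step i (inj₁ i<k)  l L≤l = empty i i<k l (≤-trans (m≤m+n L _) L≤l)
  step i (inj₂ refl) l L≤l = full⇒entry-false n k l (row-full n k L empty l L≤l)

-- The row is certainly full at column `W + L′`, and the columns from `W` on contribute nothing to
-- that count.
row-count≡ : ∀ n k W → (∀ l → W ≤ l → entry n k l ≡ false) → count< (entry n k) W ≡ n + 1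
row-count≡ n k W off with rows-eventually-empty n k
... | L , empty = ≤-antisym (row-count≤ n k W) (begin
  n + 1                                    ≤⟨ row-full n k L empty (W + L′) (m≤n+m L′ W) ⟩
  count< (entry n k) (W + L′)              ≡⟨ count<-+ (entry n k) W L′ ⟩
  count< (entry n k) W + count< (λ x → entry n k (W + x)) L′
    ≡⟨ cong (count< (entry n k) W +_) (count<-false _ L′ λ x _ → off (W + x) (m≤m+n W x)) ⟩
  count< (entry n k) W + 0                 ≡⟨ +-identityʳ _ ⟩
  count< (entry n k) W                     ∎)
  where
  open ≤-Reasoning
  L′ = L + (n + 1)

-- Vanishing of entries far from the diagonal.

⌊n/2⌋+⌊n/2⌋≤n : ∀ n → ⌊ n /2⌋ + ⌊ n /2⌋ ≤ n
⌊n/2⌋+⌊n/2⌋≤n n = begin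
  ⌊ n /2⌋ + ⌊ n /2⌋ ≤⟨ +-monoʳ-≤ ⌊ n /2⌋ (⌊n/2⌋≤⌈n/2⌉ n) ⟩
  ⌊ n /2⌋ + ⌈ n /2⌉ ≡⟨ ⌊n/2⌋+⌈n/2⌉≡n n ⟩
  n                 ∎
  where open ≤-Reasoning

module _ {n pp b} (maxOffset : IsMaxOffset n pp b) {r} (b<r : b < r) {k} (pp≤k : pp ≤ k) where

  far⇒false : ∀ c → r ≤ ∣ c - k ∣ → entry n k c ≡ false
  far⇒false c far with entry n k c in eq
  ... | false = refl
  ... | true  = contradiction
    -- Passing to 1-based indices preserves the offset and turns `pp ≤ k` into the required strict
    -- inequality.
    (proj₂ maxOffset (suc k) (suc c) (s≤s z≤n) (s≤s z≤n) (subst T (sym eq) tt) (s≤s pp≤k))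
    (<⇒≱ (<-≤-trans b<r far))

  left⇒false : ∀ c → c + r ≤ k → entry n k c ≡ false
  left⇒false c c+r≤k = far⇒false c (begin
    r          ≡⟨ m+n∸m≡n c r ⟨
    c + r ∸ c  ≤⟨ ∸-monoˡ-≤ c c+r≤k ⟩
    k ∸ c      ≤⟨ m∸n≤∣m-n∣ k c ⟩
    ∣ k - c ∣  ≡⟨ ∣-∣-comm k c ⟩
    ∣ c - k ∣  ∎)
    where open ≤-Reasoning

  right⇒false : ∀ c → k + r ≤ c → entry n k c ≡ false
  right⇒false c k+r≤c = far⇒false c (begin
    r          ≡⟨ m+n∸m≡n k r ⟨
    k + r ∸ k  ≤⟨ ∸-monoˡ-≤ k k+r≤c ⟩
    c ∸ k      ≤⟨ m∸n≤∣m-n∣ c k ⟩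
    ∣ c - k ∣  ∎)
    where open ≤-Reasoning

-- Rows of B as folded rows of A(n); writing v = w + s makes the truncated subtraction of s exact.

module _ {n pp b} (maxOffset : IsMaxOffset n pp b) {s} (b<r : b < ⌊ s /2⌋)
         {w} (pp≤w : pp ≤ w) (x : ℕ) (x<s : x < s) where

  open ≤-Reasoning

  private
    r v : ℕ
    r = ⌊ s /2⌋
    v = w + s

    h : ℕ → Bool
    h = entry n (v + x)

    pp≤k : pp ≤ v + x
    pp≤k = ≤-trans pp≤w (≤-trans (m≤m+n w s) (m≤m+n v x))

    left : ∀ c → c + r ≤ v + x → h c ≡ false
    left = left⇒false maxOffset b<r pp≤k

    right : ∀ c → v + x + r ≤ c → h c ≡ false
    right = right⇒false maxOffset b<r pp≤k

    r≤s : r ≤ s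
    r≤s = ⌊n/2⌋≤n s

    +r+r≤+s : ∀ z → z + r + r ≤ z + s
    +r+r≤+s z = begin
      z + r + r   ≡⟨ +-assoc z r r ⟩
      z + (r + r) ≤⟨ +-monoʳ-≤ z (⌊n/2⌋+⌊n/2⌋≤n s) ⟩
      z + s       ∎

    left-copy : ∀ y → y + r ≤ x + s → h (w + y) ≡ false
    left-copy y y+r≤x+s = left (w + y) (begin
      w + y + r   ≡⟨ +-assoc w y r ⟩
      w + (y + r) ≤⟨ +-monoʳ-≤ w y+r≤x+s ⟩
      w + (x + s) ≡⟨ cong (w +_) (+-comm x s) ⟩
      w + (s + x) ≡⟨ +-assoc w s x ⟨
      v + x       ∎)

    right-copy : ∀ y → x + r ≤ y + s → h (v + (s + y)) ≡ false
    right-copy y x+r≤y+s = right (v + (s + y)) (begin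
      v + x + r   ≡⟨ +-assoc v x r ⟩
      v + (x + r) ≤⟨ +-monoʳ-≤ v x+r≤y+s ⟩
      v + (y + s) ≡⟨ cong (v +_) (+-comm y s) ⟩
      v + (s + y) ∎)

    A-entry : ∀ c → A n (v + suc x) (suc c) ≡ h c
    A-entry c rewrite +-suc v x = refl

    wrapped-column : ∀ y → v + suc y ∸ s ≡ suc (w + y)
    wrapped-column y = begin-equality
      w + s + suc y ∸ s   ≡⟨ cong (λ z → z + suc y ∸ s) (+-comm w s) ⟩
      s + w + suc y ∸ s   ≡⟨ cong (_∸ s) (+-assoc s w (suc y)) ⟩
      s + (w + suc y) ∸ s ≡⟨ m+n∸m≡n s _ ⟩
      w + suc y           ≡⟨ +-suc w y ⟩
      suc (w + y)         ∎

    ≰⇒≤-pred : ∀ {a c} → ¬ (suc a ≤ suc c) → c ≤ a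
    ≰⇒≤-pred a≰c = ≤-pred (<⇒≤ (≰⇒> a≰c))

  -- The three columns are v + y - s, v + y and v + y + s. In each case of the definition of B, the
  -- two columns not selected lie at distance at least r from the diagonal.
  entryB-sum₃ : ∀ y → indicator (entryB n s v (suc x) (suc y)) ≡
    indicator (h (w + y)) + (indicator (h (w + (s + y))) + indicator (h (w + (s + (s + y)))))
  entryB-sum₃ y rewrite sym (+-assoc w s y) | sym (+-assoc w s (s + y))
    with suc x ≤? suc y + r | suc y ≤? suc x + r
  ... | yes (s≤s x≤y+r) | yes (s≤s y≤x+r)
    -- Inside the band, a shift by s ≥ 2r moves the column out to distance at least r on either
    -- side.
    rewrite left-copy y (≤-trans (+-monoˡ-≤ r y≤x+r) (+r+r≤+s x))
          | right-copy y (≤-trans (+-monoˡ-≤ r x≤y+r) (+r+r≤+s y))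
          | +-suc v y | A-entry (v + y) = sym (+-identityʳ _)
  ... | yes _ | no y≰x+r
    rewrite right (v + y) (≤-trans (≤-reflexive (+-assoc v x r)) (+-monoʳ-≤ v (≰⇒≤-pred y≰x+r)))
          | right-copy y (≤-trans (≰⇒≤-pred y≰x+r) (m≤m+n y s))
          | wrapped-column y | A-entry (w + y) = sym (+-identityʳ _)
  ... | no x≰y+r | _
    rewrite left-copy y (≤-trans (≰⇒≤-pred x≰y+r) (m≤m+n x s))
          | left (v + y) (≤-trans (≤-reflexive (+-assoc v y r)) (+-monoʳ-≤ v (≰⇒≤-pred x≰y+r)))
          | +-suc v y | A-entry (v + y + s) | +-assoc v y s | +-comm y s = refl

  before-window : count< h w ≡ 0
  before-window = count<-false h w λ c c<w → left c (begin
    c + r ≤⟨ +-mono-≤ (<⇒≤ c<w) r≤s ⟩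
    w + s ≤⟨ m≤m+n v x ⟩
    v + x ∎)

  after-window : ∀ c → w + (s + (s + s)) ≤ c → h c ≡ false
  after-window c w+3s≤c = right c (begin
    v + x + r         ≡⟨ +-assoc v x r ⟩
    -- Both x and r are at most s, so the band of this row ends within 2s columns after v.
    v + (x + r)       ≤⟨ +-monoʳ-≤ v (+-mono-≤ (<⇒≤ x<s) r≤s) ⟩
    v + (s + s)       ≡⟨ +-assoc w s (s + s) ⟩
    w + (s + (s + s)) ≤⟨ w+3s≤c ⟩
    c                 ∎)

  count-entryB : count< (λ y → entryB n s v (suc x) (suc y)) s ≡ n + 1
  count-entryB = begin-equality
    count< (λ y → entryB n s v (suc x) (suc y)) s
      ≡⟨ count<-sum₃ _ h₀ h₁ h₂ s (λ y _ → entryB-sum₃ y) ⟩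
    count< h₀ s + (count< h₁ s + count< h₂ s)
      -- The three translates are consecutive blocks of length s, so their counts join into one
      -- count starting at column w.
      ≡⟨ cong (λ z → count< h₀ s + z) (count<-+ h₁ s s) ⟨
    count< h₀ s + count< h₁ (s + s)
      ≡⟨ count<-+ h₀ s (s + s) ⟨
    count< h₀ (s + (s + s))
      ≡⟨ cong (_+ count< h₀ (s + (s + s))) before-window ⟨
    count< h w + count< h₀ (s + (s + s))
      ≡⟨ count<-+ h w (s + (s + s)) ⟨
    count< h (w + (s + (s + s)))
      ≡⟨ row-count≡ n (v + x) (w + (s + (s + s))) after-window ⟩
    n + 1 ∎
    where
    h₀ h₁ h₂ : ℕ → Bool
    h₀ y = h (w + y)
    h₁ y = h (w + (s + y))
    h₂ y = h (w + (s + (s + y)))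

theorem4p1 : ∀ (n : ℕ) → 1 ≤ n →
    ∀ (p pp b : ℕ) → IsPeriod n p → IsPreperiod n p pp → IsMaxOffset n pp b →
    ∀ (m : ℕ) → 1 ≤ m → b < ⌊ p * m /2⌋ →
    ∀ (v : ℕ) → pp + p * m ≤ v →
    ∀ (i : Fin (p * m)) → onesInRow (B n (p * m) v) i ≡ n + 1
theorem4p1 n _ p pp b _ _ maxOffset m _ b<r v pp+s≤v i =
  -- Here w is `v ∸ s`; the bound on `v` gives both s ≤ v and pp ≤ w.
  subst (λ v → onesInRow (B n s v) i ≡ n + 1) (m∸n+n≡m (m+n≤o⇒n≤o pp pp+s≤v))
    (trans (ones-tabulate (λ y → entryB n s (v ∸ s + s) (suc (toℕ i)) (suc y)) s)
           (count-entryB maxOffset b<r (m+n≤o⇒m≤o∸n pp pp+s≤v) (toℕ i) (toℕ<n i)))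
  where s = p * m
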